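{- Consider the Hilbert-style system $\mathsf{Sup}$ over the language $\mathcal{L}$ described in the context, consisting of all classical propositional tautologies (instantiated with formulas of $\mathcal{L}$), Modus Ponens, the axiom schemata $\mathbf{ID}$, $\mathbf{ST}$, $\mathbf{SH}$, $\mathbf{LL+}$ and the rules $\mathbf{RCK}$ and $\mathbf{S5_F}$. Then, for all propositional formulas $\varphi,\psi,\chi,\varphi_1,\varphi_2$: (i) (RW) if $\vdash \varphi_1\to\varphi_2$ then $\vdash (\psi\rightsquigarrow\varphi_1)\to(\psi\rightsquigarrow\varphi_2)$; (ii) (LLE) if $\vdash \varphi\leftrightarrow\psi$ then $\vdash (\varphi\rightsquigarrow\chi)\leftrightarrow(\psi\rightsquigarrow\chi)$; (iii) (AND) $\vdash ((\varphi\rightsquigarrow\psi)\land(\varphi\rightsquigarrow\chi))\to(\varphi\rightsquigarrow(\psi\land\chi))$; (iv) (CUT) $\vdash ((\varphi\rightsquigarrow\psi)\land((\varphi\land\psi)\rightsquigarrow\chi))\to(\varphi\rightsquigarrow\chi)$; (v) (OR) $\vdash ((\varphi\rightsquigarrow\psi)\land(\chi\rightsquigarrow\psi))\to((\varphi\lor\chi)\rightsquigarrow\psi)$. Here $\vdash$ denotes derivability in $\mathsf{Sup}$.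
   Context: Fix a countable set of propositional variables. Propositional formulas are given by $\varphi ::= \bot \mid p \mid \varphi\land\varphi\mid\varphi\lor\varphi\mid\varphi\to\varphi\mid\varphi\leftrightarrow\varphi\mid\neg\varphi$. The language $\mathcal{L}$ consists of formulas $\alpha ::= \varphi \mid \varphi\rightsquigarrow\varphi \mid B(\alpha)\mid \alpha*\alpha\mid\neg\alpha$ ($*\in\{\land,\lor,\to,\leftrightarrow\}$), where $\varphi$ ranges over propositional formulas; so $\rightsquigarrow$ (support) is only applied to two propositional formulas. In the axioms and rules below $\varphi,\psi,\chi,\varphi_i,\psi_i$ range over propositional formulas, and rule applications must produce formulas of $\mathcal{L}$. Axioms: $\mathbf{ID}$: $\varphi\rightsquigarrow\varphi$; $\mathbf{ST}$: $(\varphi\rightsquigarrow\bot)\to\neg\varphi$; $\mathbf{SH}$: $((\psi\land\chi)\rightsquigarrow\varphi)\to(\psi\rightsquigarrow(\chi\to\varphi))$; $\mathbf{LL+}$: $(\neg(\varphi\leftrightarrow\psi)\rightsquigarrow\bot)\to((\varphi\rightsquigarrow\chi)\leftrightarrow(\psi\rightsquigarrow\chi))$. Rule $\mathbf{RCK}$: from $(\varphi_1\land\dots\land\varphi_n)\to\varphi_{n+1}$ infer $((\psi\rightsquigarrow\varphi_1)\land\dots\land(\psi\rightsquigarrow\varphi_n))\to(\psi\rightsquigarrow\varphi_{n+1})$. Rule $\mathbf{S5_F}$: from $(\ell_1\land\dots\land\ell_n)\to\chi$ infer $(\ell_1\land\dots\land\ell_n)\to(\neg\chi\rightsquigarrow\bot)$,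 where each $\ell_j$ is either $\varphi_j\rightsquigarrow\psi_j$ or $\neg(\varphi_j\rightsquigarrow\psi_j)$ and $\chi$ is propositional. -}

module Defs where

open import Data.Bool.Base as Bool using (Bool; true; false)
open import Data.List.NonEmpty.Base using (List⁺; foldr₁; map)
open import Data.Nat.Base using (ℕ)
open import Relation.Binary.PropositionalEquality.Core using (_≡_)

infix  9 ¬_
infixr 8 _∧_
infixr 7 _∨_
infix  6 _⇝_
infixr 5 _⇒_
infix  4 _⇔_
infix  2 ⊢_

Var : Set
Var = ℕ

data PForm : Set where
  ⊥   : PForm
  var : Var → PForm
  _∧_ : PForm → PForm → PForm
  _∨_ : PForm → PForm → PForm
  _⇒_ : PForm → PForm → PForm
  _⇔_ : PForm → PForm → PForm
  ¬_  : PForm → PForm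

-- In the grammar α ::= φ | φ ⇝ φ | B(α) | α * α | ¬ α a conjunction of
-- propositional formulas, say, is one and the same formula whether produced by
-- the clause φ or by α * α.  To keep this unambiguous the clause φ is
-- unfolded here to ⊥ and the variables; the inclusion of PForm is ⌜_⌝.
data Form : Set where
  ⊥   : Form
  var : Var → Form
  _⇝_ : PForm → PForm → Form
  B   : Form → Form
  _∧_ : Form → Form → Form
  _∨_ : Form → Form → Form
  _⇒_ : Form → Form → Form
  _⇔_ : Form → Form → Form
  ¬_  : Form → Form

infix 10 _[_]

_[_] : PForm → (Var → Form) → Form
⊥       [ σ ] = ⊥
var p   [ σ ] = σ p
(φ ∧ ψ) [ σ ] = φ [ σ ] ∧ ψ [ σ ]
(φ ∨ ψ) [ σ ] = φ [ σ ] ∨ ψ [ σ ]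
(φ ⇒ ψ) [ σ ] = φ [ σ ] ⇒ ψ [ σ ]
(φ ⇔ ψ) [ σ ] = φ [ σ ] ⇔ ψ [ σ ]
(¬ φ)   [ σ ] = ¬ (φ [ σ ])

⌜_⌝ : PForm → Form
⌜ φ ⌝ = φ [ var ]

eval : (Var → Bool) → PForm → Bool
eval v ⊥       = false
eval v (var p) = v p
eval v (φ ∧ ψ) = eval v φ Bool.∧ eval v ψ
eval v (φ ∨ ψ) = eval v φ Bool.∨ eval v ψ
eval v (φ ⇒ ψ) = Bool.not (eval v φ) Bool.∨ eval v ψ
eval v (φ ⇔ ψ) = Bool.not (eval v φ Bool.xor eval v ψ)
eval v (¬ φ)   = Bool.not (eval v φ)

Tautology : PForm → Set
Tautology φ = ∀ v → eval v φ ≡ true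

⋀ᴾ : List⁺ PForm → PForm
⋀ᴾ = foldr₁ _∧_

⋀ : List⁺ Form → Form
⋀ = foldr₁ _∧_

data Literal : Set where
  pos neg : PForm → PForm → Literal

⟦_⟧ : Literal → Form
⟦ pos φ ψ ⟧ = φ ⇝ ψ
⟦ neg φ ψ ⟧ = ¬ (φ ⇝ ψ)

-- RCK and S5F are stated for n ≥ 1.  Their n = 0 instances (from φ infer ψ ⇝ φ,
-- and from χ infer ¬ χ ⇝ ⊥) are derivable: weaken the premise by the
-- antecedent ψ, resp. by a literal χ ⇝ χ, and discharge ψ ⇝ ψ, resp. χ ⇝ χ, by ID.
data ⊢_ : Form → Set where
  taut : ∀ {τ} → Tautology τ → (σ : Var → Form) → ⊢ τ [ σ ]
  MP   : ∀ {α β} → ⊢ α ⇒ β → ⊢ α → ⊢ β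
  ID   : ∀ φ → ⊢ φ ⇝ φ
  ST   : ∀ φ → ⊢ (φ ⇝ ⊥) ⇒ ¬ ⌜ φ ⌝
  SH   : ∀ φ ψ χ → ⊢ ((ψ ∧ χ) ⇝ φ) ⇒ (ψ ⇝ (χ ⇒ φ))
  LL+  : ∀ φ ψ χ → ⊢ ((¬ (φ ⇔ ψ)) ⇝ ⊥) ⇒ ((φ ⇝ χ) ⇔ (ψ ⇝ χ))
  RCK  : ∀ (φs : List⁺ PForm) φ ψ →
         ⊢ ⌜ ⋀ᴾ φs ⇒ φ ⌝ →
         ⊢ ⋀ (map (ψ ⇝_) φs) ⇒ (ψ ⇝ φ)
  S5F  : ∀ (ℓs : List⁺ Literal) χ →
         ⊢ ⋀ (map ⟦_⟧ ℓs) ⇒ ⌜ χ ⌝ →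
         ⊢ ⋀ (map ⟦_⟧ ℓs) ⇒ ((¬ χ) ⇝ ⊥)

{-# OPTIONS --safe #-}
module Submission where

-- RW and AND are instances of RCK.  For LLE, a provable equivalence is weakened
-- by a literal φ ⇝ φ so that S5F applies, and LL+ does the rest.  CUT and OR
-- rest on SH: in CUT it turns the second premise into φ ⇝ (ψ ⇒ χ); in OR, as φ
-- is equivalent to (φ ∨ χ) ∧ φ, it turns φ ⇝ ψ into (φ ∨ χ) ⇝ (φ ⇒ ψ), and
-- likewise for χ, so that RCK concludes with the help of (φ ∨ χ) ⇝ (φ ∨ χ).

open import Defs
open import Data.Bool.Base using (true; false)
open import Data.List.Base using ([]; _∷_)
open import Data.List.NonEmpty.Base using (_∷_)
open import Data.Nat.Base using (zero; suc)
open import Data.Product.Base using (_×_; _,_)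
open import Relation.Binary.PropositionalEquality.Core using (refl)

private
  variable
    α β γ : Form

infixr 4 _⨾_

-- Propositional steps are checked by truth table on a scheme in at most three variables and then
-- instantiated; two-variable schemes take `⊥` as filler for `γ`.
assign : Form → Form → Form → Var → Form
assign α β γ zero          = α
assign α β γ (suc zero)    = β
assign α β γ (suc (suc _)) = γ

const : ⊢ β → ⊢ α ⇒ β
const {β} {α} = MP (taut {τ} valid (assign α β ⊥))
  where
  τ : PForm
  τ = var 1 ⇒ var 0 ⇒ var 1
  valid : Tautology τ
  valid v with v 0 | v 1
  ... | false | false = refl
  ... | false | true  = refl
  ... | true  | false = refl
  ... | true  | true  = refl

_⨾_ : ⊢ α ⇒ β → ⊢ β ⇒ γ → ⊢ α ⇒ γ
_⨾_ {α} {β} {γ} f g = MP (MP (taut {τ} valid (assign α β γ)) f) g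
  where
  τ : PForm
  τ = (var 0 ⇒ var 1) ⇒ (var 1 ⇒ var 2) ⇒ (var 0 ⇒ var 2)
  valid : Tautology τ
  valid v with v 0 | v 1 | v 2
  ... | false | false | false = refl
  ... | false | false | true  = refl
  ... | false | true  | false = refl
  ... | false | true  | true  = refl
  ... | true  | false | false = refl
  ... | true  | false | true  = refl
  ... | true  | true  | false = refl
  ... | true  | true  | true  = refl

⟨_,_⟩ : ⊢ α ⇒ β → ⊢ α ⇒ γ → ⊢ α ⇒ (β ∧ γ)
⟨_,_⟩ {α} {β} {γ} f g = MP (MP (taut {τ} valid (assign α β γ)) f) g
  where
  τ : PForm
  τ = (var 0 ⇒ var 1) ⇒ (var 0 ⇒ var 2) ⇒ (var 0 ⇒ (var 1 ∧ var 2))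
  valid : Tautology τ
  valid v with v 0 | v 1 | v 2
  ... | false | false | false = refl
  ... | false | false | true  = refl
  ... | false | true  | false = refl
  ... | false | true  | true  = refl
  ... | true  | false | false = refl
  ... | true  | false | true  = refl
  ... | true  | true  | false = refl
  ... | true  | true  | true  = refl

π₁ : ⊢ (α ∧ β) ⇒ α
π₁ {α} {β} = taut {τ} valid (assign α β ⊥)
  where
  τ : PForm
  τ = (var 0 ∧ var 1) ⇒ var 0
  valid : Tautology τ
  valid v with v 0 | v 1
  ... | false | false = refl
  ... | false | true  = refl
  ... | true  | false = refl
  ... | true  | true  = refl

π₂ : ⊢ (α ∧ β) ⇒ β
π₂ {α} {β} = taut {τ} valid (assign α β ⊥)
  where
  τ : PForm
  τ = (var 0 ∧ var 1) ⇒ var 1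
  valid : Tautology τ
  valid v with v 0 | v 1
  ... | false | false = refl
  ... | false | true  = refl
  ... | true  | false = refl
  ... | true  | true  = refl

⇔-to : ⊢ α ⇔ β → ⊢ α ⇒ β
⇔-to {α} {β} = MP (taut {τ} valid (assign α β ⊥))
  where
  τ : PForm
  τ = (var 0 ⇔ var 1) ⇒ (var 0 ⇒ var 1)
  valid : Tautology τ
  valid v with v 0 | v 1
  ... | false | false = refl
  ... | false | true  = refl
  ... | true  | false = refl
  ... | true  | true  = refl

RW : ∀ φ₁ φ₂ ψ → ⊢ ⌜ φ₁ ⇒ φ₂ ⌝ → ⊢ (ψ ⇝ φ₁) ⇒ (ψ ⇝ φ₂)
-- On a singleton list both conjunctions compute to their only member.
RW φ₁ φ₂ ψ = RCK (φ₁ ∷ []) φ₂ ψ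

LLE : ∀ φ ψ χ → ⊢ ⌜ φ ⇔ ψ ⌝ → ⊢ (φ ⇝ χ) ⇔ (ψ ⇝ χ)
LLE φ ψ χ φ⇔ψ =
  -- `ID φ` discharges the auxiliary literal, which leaves exactly the antecedent of `LL+`.
  MP (LL+ φ ψ χ) (MP (S5F (pos φ φ ∷ []) (φ ⇔ ψ) (const φ⇔ψ)) (ID φ))

AND : ∀ φ ψ χ → ⊢ ((φ ⇝ ψ) ∧ (φ ⇝ χ)) ⇒ (φ ⇝ (ψ ∧ χ))
-- The premise of `RCK` is here an identity implication, obtained by re-pairing the projections.
AND φ ψ χ = RCK (ψ ∷ χ ∷ []) (ψ ∧ χ) φ ⟨ π₁ , π₂ ⟩

-- Modus ponens is a tautology, so `RCK` carries it over to what `φ` supports. As `⌜_⌝` is a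
-- substitution, it unfolds through the connectives, and the instance of `τ` is the required premise
-- by computation.
⇝-MP : ∀ φ ψ χ → ⊢ ((φ ⇝ ψ) ∧ (φ ⇝ (ψ ⇒ χ))) ⇒ (φ ⇝ χ)
⇝-MP φ ψ χ = RCK (ψ ∷ (ψ ⇒ χ) ∷ []) χ φ
  (taut {τ} valid (assign ⌜ ψ ⌝ ⌜ χ ⌝ ⊥))
  where
  τ : PForm
  τ = (var 0 ∧ (var 0 ⇒ var 1)) ⇒ var 1
  valid : Tautology τ
  valid v with v 0 | v 1
  ... | false | false = refl
  ... | false | true  = refl
  ... | true  | false = refl
  ... | true  | true  = refl

CUT : ∀ φ ψ χ → ⊢ ((φ ⇝ ψ) ∧ ((φ ∧ ψ) ⇝ χ)) ⇒ (φ ⇝ χ)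
CUT φ ψ χ = ⟨ π₁ , π₂ ⨾ SH χ φ ψ ⟩ ⨾ ⇝-MP φ ψ χ

-- The hypothesis says that `φ` entails `χ`. `LLE` then replaces `φ` by `χ ∧ φ` on the left, and
-- `SH` moves `φ` to the right.
⇝-weaken : ∀ φ ψ χ → ⊢ ⌜ φ ⇔ (χ ∧ φ) ⌝ → ⊢ (φ ⇝ ψ) ⇒ (χ ⇝ (φ ⇒ ψ))
⇝-weaken φ ψ χ φ⇔χ∧φ = ⇔-to (LLE φ (χ ∧ φ) ψ φ⇔χ∧φ) ⨾ SH ψ χ φ

OR : ∀ φ ψ χ → ⊢ ((φ ⇝ ψ) ∧ (χ ⇝ ψ)) ⇒ ((φ ∨ χ) ⇝ ψ)
OR φ ψ χ =
  -- The pairs nest to the right, as `⋀` does on the three formulas given to `RCK`.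
  ⟨ const (ID (φ ∨ χ)) , ⟨ π₁ ⨾ ⇝-weaken φ ψ (φ ∨ χ) absorbˡ
                         , π₂ ⨾ ⇝-weaken χ ψ (φ ∨ χ) absorbʳ ⟩ ⟩
  ⨾ RCK ((φ ∨ χ) ∷ (φ ⇒ ψ) ∷ (χ ⇒ ψ) ∷ []) ψ (φ ∨ χ) cases
  where
  absorbˡ : ⊢ ⌜ φ ⇔ ((φ ∨ χ) ∧ φ) ⌝
  absorbˡ = taut {τ} valid (assign ⌜ φ ⌝ ⌜ χ ⌝ ⊥)
    where
    τ : PForm
    τ = var 0 ⇔ ((var 0 ∨ var 1) ∧ var 0)
    valid : Tautology τ
    valid v with v 0 | v 1
    ... | false | false = refl
    ... | false | true  = refl
    ... | true  | false = refl
    ... | true  | true  = refl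

  absorbʳ : ⊢ ⌜ χ ⇔ ((φ ∨ χ) ∧ χ) ⌝
  absorbʳ = taut {τ} valid (assign ⌜ φ ⌝ ⌜ χ ⌝ ⊥)
    where
    τ : PForm
    τ = var 1 ⇔ ((var 0 ∨ var 1) ∧ var 1)
    valid : Tautology τ
    valid v with v 0 | v 1
    ... | false | false = refl
    ... | false | true  = refl
    ... | true  | false = refl
    ... | true  | true  = refl

  cases : ⊢ ⌜ ((φ ∨ χ) ∧ (φ ⇒ ψ) ∧ (χ ⇒ ψ)) ⇒ ψ ⌝
  -- Proof by cases; `χ` is now `var 2`, while in the two absorption laws it is `var 1`.
  cases = taut {τ} valid (assign ⌜ φ ⌝ ⌜ ψ ⌝ ⌜ χ ⌝)
    where
    τ : PForm
    τ = ((var 0 ∨ var 2) ∧ (var 0 ⇒ var 1) ∧ (var 2 ⇒ var 1)) ⇒ var 1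
    valid : Tautology τ
    valid v with v 0 | v 1 | v 2
    ... | false | false | false = refl
    ... | false | false | true  = refl
    ... | false | true  | false = refl
    ... | false | true  | true  = refl
    ... | true  | false | false = refl
    ... | true  | false | true  = refl
    ... | true  | true  | false = refl
    ... | true  | true  | true  = refl

theorem1 : ∀ (φ ψ χ φ₁ φ₂ : PForm) →
    (⊢ ⌜ φ₁ ⇒ φ₂ ⌝ → ⊢ (ψ ⇝ φ₁) ⇒ (ψ ⇝ φ₂))
    × (⊢ ⌜ φ ⇔ ψ ⌝ → ⊢ (φ ⇝ χ) ⇔ (ψ ⇝ χ))
    × (⊢ ((φ ⇝ ψ) ∧ (φ ⇝ χ)) ⇒ (φ ⇝ (ψ ∧ χ)))
    × (⊢ ((φ ⇝ ψ) ∧ ((φ ∧ ψ) ⇝ χ)) ⇒ (φ ⇝ χ))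
    × (⊢ ((φ ⇝ ψ) ∧ (χ ⇝ ψ)) ⇒ ((φ ∨ χ) ⇝ ψ))
theorem1 φ ψ χ φ₁ φ₂ =
  RW φ₁ φ₂ ψ , LLE φ ψ χ , AND φ ψ χ , CUT φ ψ χ , OR φ ψ χ
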